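{- Let $(A,\mathit{Con},\Delta)$ be a normal default structure (with trivial entailment) and let $\mid\!\sim_A$ be its skeptical nonmonotonic consequence relation. Then $\mid\!\sim_A$ satisfies cautious cut: for all finite sets $X,T,Y\in\mathit{Con}$ with $X\cup T\in\mathit{Con}$, if $X\mid\!\sim_A T$ and $X\cup T\mid\!\sim_A Y$, then $X\mid\!\sim_A Y$.
   Context: A normal default structure (with trivial entailment) is a triple $(A,\mathit{Con},\Delta)$ where $A$ is a set of tokens; $\mathit{Con}$ is a set of finite subsets of $A$ such that $\emptyset\in\mathit{Con}$, $X\subseteq Y\in\mathit{Con}$ implies $X\in\mathit{Con}$, and $\{a\}\in\mathit{Con}$ for every $a\in A$; an arbitrary subset of $A$ is called consistent (written $X\in\mathit{Con}$) if all its finite subsets lie in $\mathit{Con}$; and $\Delta$ is a set of normal defaults, each written $\frac{X:a}{a}$ with $X\in\mathit{Con}$ finite and $a\in A$. For a consistent set $x\subseteq A$ and any $S\subseteq A$, define $\phi(x,S,0)=x$ and $\phi(x,S,i+1)=\phi(x,S,i)\cup\{a\mid \frac{X:a}{a}\in\Delta,\ X\subseteq\phi(x,S,i),\ \{a\}\cup S\in\mathit{Con}\}$, and $\Phi(x,S)=\bigcup_{i\ge0}\phi(x,S,i)$. A set $y$ is an extension of $x$ if $\Phi(x,y)=y$. The skeptical consequence relation is defined for $X\in\mathit{Con}$ and $a\in A$ by $X\mid\!\sim_A a$ iff $a$ belongs to every extension of $X$; for a finite set $Y$, $X\mid\!\sim_A Y$ means $X\mid\!\sim_A b$ for every $b\in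 Y$. -}

module Defs where

open import Data.List.Base using (List; []; [_])
open import Data.List.Membership.Propositional using () renaming (_∈_ to _∈ˡ_)
open import Data.List.Relation.Binary.Subset.Propositional using () renaming (_⊆_ to _⊆ˡ_)
open import Data.Nat.Base using (ℕ; zero; suc)
open import Data.Product.Base using (_×_; ∃-syntax)
open import Level using (Level) renaming (suc to lsuc)
open import Relation.Binary.Core using (REL)
open import Relation.Unary using (Pred; _∈_; _⊆_; _≐_; _∪_; ｛_｝; ⋃)

-- Finite subsets of A are represented by lists, read up to having the same
-- members; arbitrary subsets are predicates.  Since Con is closed under list
-- inclusion, it does not depend on the list chosen for a finite set.
record NormalDefaultStructure (ℓ : Level) : Set (lsuc ℓ) where
  field
    A             : Set ℓ
    Con           : Pred (List A) ℓ
    ∅-con         : Con []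
    ⊆-con         : ∀ {X Y} → X ⊆ˡ Y → Con Y → Con X
    singleton-con : ∀ a → Con [ a ]
    -- Δ X a says that the normal default X : a / a belongs to Δ.
    Δ             : REL (List A) A ℓ
    Δ-con         : ∀ {X a} → Δ X a → Con X

  ⟦_⟧ : List A → Pred A ℓ
  ⟦ X ⟧ a = a ∈ˡ X

  Consistent : Pred A ℓ → Set ℓ
  Consistent S = ∀ (F : List A) → ⟦ F ⟧ ⊆ S → Con F

  φ : Pred A ℓ → Pred A ℓ → ℕ → Pred A ℓ
  φ x S zero    = x
  φ x S (suc i) =
    φ x S i ∪ (λ a → ∃[ X ] (Δ X a × ⟦ X ⟧ ⊆ φ x S i × Consistent (｛ a ｝ ∪ S)))

  Φ : Pred A ℓ → Pred A ℓ → Pred A ℓ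
  Φ x S = ⋃ ℕ (φ x S)

  IsExtension : Pred A ℓ → Pred A ℓ → Set ℓ
  IsExtension x y = Φ x y ≐ y

  infix 4 _∣∼_ _∣∼ˢ_

  -- Only meant for X with Con X, as is φ only for consistent x.
  _∣∼_ : List A → A → Set (lsuc ℓ)
  X ∣∼ a = ∀ (y : Pred A ℓ) → IsExtension ⟦ X ⟧ y → a ∈ y

  _∣∼ˢ_ : List A → List A → Set (lsuc ℓ)
  X ∣∼ˢ Y = ∀ {b} → b ∈ˡ Y → X ∣∼ b

{-# OPTIONS --safe #-}
module Submission where

-- An extension y of X is closed under the defaults applicable relative to y:
-- the finite premise set of such a default already lies in some stage
-- φ(X, y, i).  So if T ⊆ y, then y is also an extension of X ∪ T, and
-- whatever follows skeptically from X ∪ T belongs to y.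

open import Defs
open import Level using (Level)
open import Data.List.Base using (List; []; _∷_; _++_)
open import Data.List.Membership.Propositional.Properties using (∈-++⁺ˡ; ∈-++⁻)
open import Data.List.Relation.Unary.Any using (here; there)
open import Data.Nat.Base using (zero; suc; _≤′_; ≤′-refl; ≤′-step; _⊔_)
open import Data.Nat.Properties using (m≤m⊔n; m≤n⊔m; ≤⇒≤′)
open import Data.Product.Base using (_,_; ∃-syntax)
open import Data.Sum.Base using (inj₁; inj₂; [_,_]′)
open import Relation.Binary.PropositionalEquality.Core using (refl)
open import Relation.Unary using (Pred; _∈_; _⊆_; _∪_; ｛_｝)

module _ {ℓ : Level} (D : NormalDefaultStructure ℓ) where
  open NormalDefaultStructure D

  φ-monoʳ : ∀ {x S i j} → i ≤′ j → φ x S i ⊆ φ x S j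
  φ-monoʳ ≤′-refl       a∈ = a∈
  φ-monoʳ (≤′-step i≤j) a∈ = inj₁ (φ-monoʳ i≤j a∈)

  -- With `S` fixed, the consistency test is the same from both starting sets, so only premises have
  -- to be transferred.
  φ-monoˡ : ∀ {x x′ S} → x ⊆ x′ → ∀ i → φ x S i ⊆ φ x′ S i
  φ-monoˡ x⊆x′ zero    a∈ = x⊆x′ a∈
  φ-monoˡ x⊆x′ (suc i) (inj₁ a∈) = inj₁ (φ-monoˡ x⊆x′ i a∈)
  φ-monoˡ x⊆x′ (suc i) (inj₂ (Z , δ , Z⊆ , con)) =
    inj₂ (Z , δ , (λ z∈ → φ-monoˡ x⊆x′ i (Z⊆ z∈)) , con)

  -- The stages increase, so the maximum of the stages where the finitely many members appear serves
  -- for all.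
  Φ-finitary : ∀ {x S} (Z : List A) → ⟦ Z ⟧ ⊆ Φ x S → ∃[ i ] ⟦ Z ⟧ ⊆ φ x S i
  Φ-finitary []      _  = 0 , λ ()
  Φ-finitary (z ∷ Z) Z⊆ with Z⊆ (here refl) | Φ-finitary Z (λ z∈ → Z⊆ (there z∈))
  ... | i , z∈φ | j , Z⊆φ = i ⊔ j , λ where
    (here refl) → φ-monoʳ (≤⇒≤′ (m≤m⊔n i j)) z∈φ
    (there z∈)  → φ-monoʳ (≤⇒≤′ (m≤n⊔m i j)) (Z⊆φ z∈)

  Φ-closed : ∀ {x S Z a} → Δ Z a → ⟦ Z ⟧ ⊆ Φ x S → Consistent (｛ a ｝ ∪ S) → a ∈ Φ x S
  Φ-closed {Z = Z} δ Z⊆ con with Φ-finitary Z Z⊆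
  ... | i , Z⊆φ = suc i , inj₂ (Z , δ , Z⊆φ , con)

  -- One inclusion is monotonicity in the starting set; for the other, induction on stages shows
  -- that no default leads out of `y`.
  extension-intermediate : ∀ {x x′ y : Pred A ℓ} →
    x ⊆ x′ → x′ ⊆ y → IsExtension x y → IsExtension x′ y
  extension-intermediate {x′ = x′} {y} x⊆x′ x′⊆y (Φ⊆y , y⊆Φ) =
    (λ (i , a∈) → φ⊆y i a∈) , (λ a∈ → let i , a∈φ = y⊆Φ a∈ in i , φ-monoˡ x⊆x′ i a∈φ)
    where
    φ⊆y : ∀ i → φ x′ y i ⊆ y
    φ⊆y zero    a∈        = x′⊆y a∈
    φ⊆y (suc i) (inj₁ a∈) = φ⊆y i a∈
    φ⊆y (suc i) (inj₂ (Z , δ , Z⊆ , con)) =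
      -- By induction `Z` lies in `y`, hence in `Φ x y`, so the same default fires from `x`: its
      -- test `con` involves only `y`.
      Φ⊆y (Φ-closed δ (λ z∈ → y⊆Φ (φ⊆y i (Z⊆ z∈))) con)

theorem3 : ∀ {ℓ : Level} (D : NormalDefaultStructure ℓ) → let open NormalDefaultStructure D in
    ∀ (X T Y : List A) → Con X → Con T → Con Y → Con (X ++ T) →
    X ∣∼ˢ T → (X ++ T) ∣∼ˢ Y → X ∣∼ˢ Y
theorem3 D X T Y _ _ _ _ X∣∼T X++T∣∼Y b∈Y y ext@(Φ⊆y , _) =
  X++T∣∼Y b∈Y y (extension-intermediate D ∈-++⁺ˡ X++T⊆y ext)
  where
  open NormalDefaultStructure D
  X++T⊆y : ⟦ X ++ T ⟧ ⊆ y
  -- Members of `X` form stage 0 of `Φ`; those of `T` lie in every extension of `X`.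
  X++T⊆y a∈ = [ (λ a∈X → Φ⊆y (0 , a∈X)) , (λ a∈T → X∣∼T a∈T y ext) ]′ (∈-++⁻ X a∈)
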